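{- If $A:\mathcal U^e$ is a cofibrant exo-type and the natural number exo-type $\mathbb N^e$ is cofibrant, then the exo-type $\mathsf{List}^e(A)$ of finite exo-lists of terms of $A$ is cofibrant.
   Context: Setting: two-level type theory (2LTT). There is a hierarchy of universes $\mathcal U$ whose terms are called types and which obeys homotopy type theory (with the usual $\prod,\sum,+,\mathbf 1,\mathbf 0,\mathbb N$ and identity type $=$), and a hierarchy of exo-universes $\mathcal U^e$ whose terms are called exo-types, with their own formers $\prod^e,\sum^e,+^e,\mathbf 1^e,\mathbf 0^e,\mathbb N^e$ and exo-equality $=^e$. Every type is also an exo-type. Exo-level inductive exo-types eliminate into arbitrary exo-types, while inductive types eliminate only into types. Axioms: univalence (hence function extensionality) for $=$; function extensionality and uniqueness of identity proofs for $=^e$. An exo-isomorphism $A\cong B$ of exo-types consists of $f:A\to B$, $g:B\to A$ with $f\circ g=^e\mathrm{id}_B$ and $g\circ f=^e\mathrm{id}_A$. An exo-type $A$ is fibrant if there is a type $RA:\mathcal U$ (its fibrant match) with $A\cong RA$. An exo-type $A$ is cofibrant if (1) for any $Y:A\to\mathcal U$ the exo-type $\prod^e_{a:A}Y(a)$ is fibrant, and (2) in that case, if each $Y(a)$ is contractible (with respect to $=$), then so is the fibrant match of $\prod^e_{a:A}Y(a)$. For $A:\mathcal U^e$, $\mathsf{List}^e(A):\mathcal U^e$ is the inductive exo-type with constructors $[\,]^e:\mathsf{List}^e(A)$ and $::^e\;:A\to\mathsf{List}^e(A)\to\mathsf{List}^e(A)$. -}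

{-# OPTIONS --with-K #-}
-- The exo-level of two-level type theory is played by Agda itself: the
-- exo-universe 𝒰ᵉ at level ℓ is Set ℓ, exo-equality is _≡_ (axiom K gives
-- uniqueness of identity proofs), and ∏ᵉ, ℕᵉ, Listᵉ are Agda's function
-- types, ℕ and List.  The inner level is a hierarchy of Tarski universes
-- Ty ℓ, whose decoding El is the coercion from types to exo-types.
-- Judgemental computation rules of the inner level become exo-equalities.
module Defs where

open import Level using (Level; Setω; _⊔_) renaming (zero to lzero; suc to lsuc)
open import Function.Base using (_∘_; id)
open import Relation.Binary.PropositionalEquality.Core using (_≡_; sym; subst)
open import Axiom.Extensionality.Propositional using (Extensionality)

private
  variable
    i j k : Level

infix 4 _≅_

record _≅_ (A : Set i) (B : Set j) : Set (i ⊔ j) where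
  field
    to      : A → B
    from    : B → A
    to∘from : to ∘ from ≡ id
    from∘to : from ∘ to ≡ id

-- The formers of the inner level.  Every eliminator has a motive valued in
-- types, never in arbitrary exo-types.
record InnerTypes : Setω where
  infixr 6 _+ᵗ_
  field
    Ty : ∀ ℓ → Set (lsuc ℓ)
    El : Ty i → Set i

    -- The universes are themselves types.
    𝒰      : ∀ ℓ → Ty (lsuc ℓ)
    decode : El (𝒰 i) → Ty i
    code   : Ty i → El (𝒰 i)
    decode-code : (A : Ty i) → decode (code A) ≡ A
    code-decode : (a : El (𝒰 i)) → code (decode a) ≡ a

    -- Cumulativity of the hierarchy.
    Liftᵗ : ∀ j → Ty i → Ty (i ⊔ j)
    lift  : ∀ j {A : Ty i} → El A → El (Liftᵗ j A)
    lower : ∀ j {A : Ty i} → El (Liftᵗ j A) → El A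
    lower-lift : ∀ j {A : Ty i} (x : El A) → lower j (lift j x) ≡ x
    lift-lower : ∀ j {A : Ty i} (x : El (Liftᵗ j A)) → lift j (lower j x) ≡ x

    Πᵗ  : (A : Ty i) → (El A → Ty j) → Ty (i ⊔ j)
    lam : {A : Ty i} {B : El A → Ty j} → ((x : El A) → El (B x)) → El (Πᵗ A B)
    app : {A : Ty i} {B : El A → Ty j} → El (Πᵗ A B) → (x : El A) → El (B x)
    Π-β : {A : Ty i} {B : El A → Ty j} (f : (x : El A) → El (B x)) →
          app {B = B} (lam f) ≡ f
    Π-η : {A : Ty i} {B : El A → Ty j} (f : El (Πᵗ A B)) → lam (app f) ≡ f

    Σᵗ   : (A : Ty i) → (El A → Ty j) → Ty (i ⊔ j)
    pair : {A : Ty i} {B : El A → Ty j} (x : El A) → El (B x) → El (Σᵗ A B)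
    fst  : {A : Ty i} {B : El A → Ty j} → El (Σᵗ A B) → El A
    snd  : {A : Ty i} {B : El A → Ty j} (p : El (Σᵗ A B)) → El (B (fst p))
    fst-β : {A : Ty i} {B : El A → Ty j} (x : El A) (y : El (B x)) →
            fst {B = B} (pair x y) ≡ x
    snd-β : {A : Ty i} {B : El A → Ty j} (x : El A) (y : El (B x)) →
            subst (λ z → El (B z)) (fst-β {B = B} x y) (snd (pair {B = B} x y)) ≡ y
    Σ-η   : {A : Ty i} {B : El A → Ty j} (p : El (Σᵗ A B)) →
            pair (fst p) (snd p) ≡ p

    _+ᵗ_ : Ty i → Ty j → Ty (i ⊔ j)
    inl  : {A : Ty i} {B : Ty j} → El A → El (A +ᵗ B)
    inr  : {A : Ty i} {B : Ty j} → El B → El (A +ᵗ B)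
    +-elim : {A : Ty i} {B : Ty j} (C : El (A +ᵗ B) → Ty k) →
             ((x : El A) → El (C (inl x))) → ((y : El B) → El (C (inr y))) →
             (z : El (A +ᵗ B)) → El (C z)
    +-β-inl : {A : Ty i} {B : Ty j} (C : El (A +ᵗ B) → Ty k)
              (l : (x : El A) → El (C (inl x))) (r : (y : El B) → El (C (inr y)))
              (x : El A) → +-elim C l r (inl x) ≡ l x
    +-β-inr : {A : Ty i} {B : Ty j} (C : El (A +ᵗ B) → Ty k)
              (l : (x : El A) → El (C (inl x))) (r : (y : El B) → El (C (inr y)))
              (y : El B) → +-elim C l r (inr y) ≡ r y

    𝟏ᵗ  : Ty lzero
    tt  : El 𝟏ᵗ
    𝟏-η : (x : El 𝟏ᵗ) → tt ≡ x

    𝟎ᵗ     : Ty lzero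
    𝟎-elim : (C : El 𝟎ᵗ → Ty k) (x : El 𝟎ᵗ) → El (C x)

    ℕᵗ : Ty lzero
    ze : El ℕᵗ
    su : El ℕᵗ → El ℕᵗ
    ℕ-elim : (C : El ℕᵗ → Ty k) → El (C ze) →
             ((n : El ℕᵗ) → El (C n) → El (C (su n))) → (n : El ℕᵗ) → El (C n)
    ℕ-β-ze : (C : El ℕᵗ → Ty k) (z : El (C ze))
             (s : (n : El ℕᵗ) → El (C n) → El (C (su n))) →
             ℕ-elim C z s ze ≡ z
    ℕ-β-su : (C : El ℕᵗ → Ty k) (z : El (C ze))
             (s : (n : El ℕᵗ) → El (C n) → El (C (su n))) (n : El ℕᵗ) →
             ℕ-elim C z s (su n) ≡ s n (ℕ-elim C z s n)

    Idᵗ   : (A : Ty i) → El A → El A → Ty i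
    reflᵗ : {A : Ty i} {x : El A} → El (Idᵗ A x x)
    J     : {A : Ty i} {x : El A} (C : (y : El A) → El (Idᵗ A x y) → Ty k) →
            El (C x reflᵗ) → (y : El A) (p : El (Idᵗ A x y)) → El (C y p)
    J-β   : {A : Ty i} {x : El A} (C : (y : El A) → El (Idᵗ A x y) → Ty k)
            (c : El (C x reflᵗ)) → J C c x reflᵗ ≡ c

module _ (I : InnerTypes) where
  open InnerTypes I

  isContr : Ty i → Ty i
  isContr A = Σᵗ A λ x → Πᵗ A λ y → Idᵗ A x y

  fiber : (A : Ty i) (B : Ty j) → (El A → El B) → El B → Ty (i ⊔ j)
  fiber A B f y = Σᵗ A λ x → Idᵗ B (f x) y

  isEquiv : (A : Ty i) (B : Ty j) → (El A → El B) → Ty (i ⊔ j)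
  isEquiv A B f = Πᵗ B λ y → isContr (fiber A B f y)

  Equiv : Ty i → Ty j → Ty (i ⊔ j)
  Equiv A B = Σᵗ (Πᵗ A λ _ → B) λ f → isEquiv A B (app f)

  idIsEquiv : (A : Ty i) → El (isEquiv A A id)
  idIsEquiv A = lam λ y → pair (pair y reflᵗ) (lam λ p →
    subst (λ q → El (Idᵗ (fiber A A id y) (pair y reflᵗ) q)) (Σ-η p)
      (J (λ z q → Idᵗ (fiber A A id z) (pair z reflᵗ) (pair (fst p) q))
         reflᵗ y (snd p)))

  idEquiv : (A : Ty i) → El (Equiv A A)
  idEquiv A = pair (lam id)
    (subst (λ f → El (isEquiv A A f)) (sym (Π-β id)) (idIsEquiv A))

  idToEquiv : (a b : El (𝒰 i)) → El (Idᵗ (𝒰 i) a b) →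
              El (Equiv (decode a) (decode b))
  idToEquiv a b = J (λ b _ → Equiv (decode a) (decode b)) (idEquiv (decode a)) b

  Univalence : Setω
  Univalence = ∀ {ℓ} (a b : El (𝒰 ℓ)) →
    El (isEquiv (Idᵗ (𝒰 ℓ) a b) (Equiv (decode a) (decode b)) (idToEquiv a b))

record TwoLevelTypeTheory : Setω where
  field
    innerTypes : InnerTypes
    univalence : Univalence innerTypes
    exoFunext  : ∀ {i j} → Extensionality i j
  open InnerTypes innerTypes public

module _ (𝕋 : TwoLevelTypeTheory) where
  open TwoLevelTypeTheory 𝕋

  record IsFibrant (A : Set i) : Set (lsuc i) where
    field
      match : Ty i
      iso   : A ≅ El match

  open IsFibrant

  record IsCofibrantAt (j : Level) (A : Set i) : Set (lsuc (i ⊔ j)) where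
    field
      ∏-fibrant : (Y : A → Ty j) → IsFibrant ((a : A) → El (Y a))
      ∏-contr   : (Y : A → Ty j) →
                  ((a : A) → El (isContr innerTypes (Y a))) →
                  El (isContr innerTypes (match (∏-fibrant Y)))

  -- Families of types over A may land in any universe.
  IsCofibrant : Set i → Setω
  IsCofibrant A = ∀ j → IsCofibrantAt j A

{-# OPTIONS --safe #-}
-- Exo-lists are stratified by their length: ∏ᵉ over Listᵉ A is ∏ᵉ over n : ℕᵉ
-- of ∏ᵉ over the lists of length n, and the latter is an n-fold iterated ∏ᵉ
-- over A.  Cofibrancy of A therefore yields, by induction on n, a fibrant match
-- for each stratum, and cofibrancy of ℕᵉ assembles them.
module Submission where

open import Defs
open import Level using (Level; _⊔_)
open import Function.Base using (_∘_)
open import Data.Nat.Base using (ℕ; zero; suc)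
open import Data.Nat.Properties using (suc-injective)
open import Data.List.Base using (List; []; _∷_; length)
open import Relation.Binary.PropositionalEquality
  using (_≡_; refl; trans; cong; cong-app; subst)

private
  variable
    i j k : Level

≅-trans : {A : Set i} {B : Set j} {C : Set k} → A ≅ B → B ≅ C → A ≅ C
≅-trans f g = record
  { to      = G.to ∘ F.to
  ; from    = F.from ∘ G.from
  ; to∘from = trans (cong (λ h → G.to ∘ h ∘ G.from) F.to∘from) G.to∘from
  ; from∘to = trans (cong (λ h → F.from ∘ h ∘ F.to) G.from∘to) F.from∘to
  }
  where
    module F = _≅_ f
    module G = _≅_ g

module _ (𝕋 : TwoLevelTypeTheory) where
  open TwoLevelTypeTheory 𝕋
  open IsFibrant
  open IsCofibrantAt
  open _≅_

  Π-cong-≅ : {A : Set i} {B : A → Set j} {C : A → Set k} →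
             (∀ a → B a ≅ C a) → ((a : A) → B a) ≅ ((a : A) → C a)
  Π-cong-≅ e = record
    { to      = λ f a → to (e a) (f a)
    ; from    = λ g a → from (e a) (g a)
    ; to∘from = exoFunext λ g → exoFunext λ a → cong-app (to∘from (e a)) (g a)
    ; from∘to = exoFunext λ f → exoFunext λ a → cong-app (from∘to (e a)) (f a)
    }

  -- Serves the stratum of length zero, whose match is a lifted type. `J` carries the path from the
  -- centre to `lower j y` over to the lifts, and the exo-equality `lift-lower` corrects its
  -- endpoint to `y`.
  Liftᵗ-isContr : ∀ j (A : Ty i) → El (isContr innerTypes A) →
                  El (isContr innerTypes (Liftᵗ j A))
  Liftᵗ-isContr j A c = pair (lift j (fst c)) (lam λ y →
    subst (λ z → El (Idᵗ (Liftᵗ j A) (lift j (fst c)) z)) (lift-lower j y)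
      (J (λ z _ → Idᵗ (Liftᵗ j A) (lift j (fst c)) (lift j z)) reflᵗ
         (lower j y) (app (snd c) (lower j y))))

  module _ {A : Set i} where

    -- The stratum is the fibre of `length` over `n`, in curried form, so `Y` remains a family over
    -- `List A` and needs no reindexing along vectors.
    ΠLength : (List A → Ty j) → ℕ → Set (i ⊔ j)
    ΠLength Y n = (xs : List A) → length xs ≡ n → El (Y xs)

    Π-List-≅ : (Y : List A → Ty j) → ((xs : List A) → El (Y xs)) ≅ (∀ n → ΠLength Y n)
    Π-List-≅ Y = record
      { to      = λ f n xs _ → f xs
      ; from    = λ g xs → g (length xs) xs refl
      ; to∘from = exoFunext λ g → exoFunext λ n → exoFunext λ xs →
                  exoFunext λ { refl → refl }
      ; from∘to = refl
      }

    -- Only `[]` has length zero. The lift is there because the stratum quantifies over `List A` and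
    -- so lives at level `i ⊔ j`, where its match must lie too.
    ΠLength-zero-≅ : (Y : List A → Ty j) → ΠLength Y zero ≅ El (Liftᵗ i (Y []))
    ΠLength-zero-≅ Y = record
      { to      = λ f → lift i (f [] refl)
      ; from    = λ { y [] _ → lower i y }
      ; to∘from = exoFunext (lift-lower i)
      ; from∘to = exoFunext λ f → exoFunext λ
          { []      → exoFunext λ { refl → lower-lift i (f [] refl) }
          ; (_ ∷ _) → exoFunext λ ()
          }
      }

    ΠLength-suc-≅ : (Y : List A → Ty j) (n : ℕ) →
                    ΠLength Y (suc n) ≅ ((a : A) → ΠLength (Y ∘ (a ∷_)) n)
    ΠLength-suc-≅ Y n = record
      { to      = λ f a xs e → f (a ∷ xs) (cong suc e)
      ; from    = λ { g (a ∷ xs) e → g a xs (suc-injective e) }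
      -- Once the length equation is `refl`, `suc-injective` after `cong suc` computes away.
      ; to∘from = exoFunext λ g → exoFunext λ a → exoFunext λ xs →
                  exoFunext λ { refl → refl }
      ; from∘to = exoFunext λ f → exoFunext λ
          { []       → exoFunext λ ()
          ; (a ∷ xs) → exoFunext λ { refl → refl }
          }
      }

    module _ (cA : IsCofibrantAt 𝕋 (i ⊔ j) A) where

      -- The induction keeps `Y` general, since fixing a head `a` replaces it by `Y ∘ (a ∷_)`. Every
      -- match stays at level `i ⊔ j`, so one level of cofibrancy of `A` covers all `n`.
      ΠLength-fibrant : (Y : List A → Ty j) (n : ℕ) → IsFibrant 𝕋 (ΠLength Y n)
      ΠLength-fibrant Y zero = record { iso = ΠLength-zero-≅ Y }
      ΠLength-fibrant Y (suc n) = record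
        { iso = ≅-trans (ΠLength-suc-≅ Y n)
                  (≅-trans (Π-cong-≅ λ a → iso (ΠLength-fibrant (Y ∘ (a ∷_)) n))
                    (iso (∏-fibrant cA λ a → match (ΠLength-fibrant (Y ∘ (a ∷_)) n))))
        }

      -- The match at `suc n` is by construction the one supplied by `∏-fibrant cA`, so `∏-contr cA`
      -- applies to it without transport.
      ΠLength-contr : (Y : List A → Ty j) →
                      ((xs : List A) → El (isContr innerTypes (Y xs))) →
                      (n : ℕ) → El (isContr innerTypes (match (ΠLength-fibrant Y n)))
      ΠLength-contr Y c zero    = Liftᵗ-isContr i (Y []) (c [])
      ΠLength-contr Y c (suc n) =
        ∏-contr cA _ λ a → ΠLength-contr (Y ∘ (a ∷_)) (c ∘ (a ∷_)) n

      List-cofibrantAt : IsCofibrantAt 𝕋 (i ⊔ j) ℕ → IsCofibrantAt 𝕋 j (List A)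
      List-cofibrantAt cℕ = record
        { ∏-fibrant = λ Y → record
            { iso = ≅-trans (Π-List-≅ Y)
                      (≅-trans (Π-cong-≅ (iso ∘ ΠLength-fibrant Y))
                        (iso (∏-fibrant cℕ (match ∘ ΠLength-fibrant Y))))
            }
        -- Here too the match is literally the one `cℕ` gives for the family of matches of the
        -- strata.
        ; ∏-contr = λ Y c → ∏-contr cℕ _ (ΠLength-contr Y c)
        }

proposition3p3 : (𝕋 : TwoLevelTypeTheory) → ∀ {ℓ} (A : Set ℓ) →
    IsCofibrant 𝕋 A → IsCofibrant 𝕋 ℕ → IsCofibrant 𝕋 (List A)
proposition3p3 𝕋 {ℓ} A cA cℕ j = List-cofibrantAt 𝕋 (cA (ℓ ⊔ j)) (cℕ (ℓ ⊔ j))
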